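{- For every positive integer $n$ and every integer $k\ge 0$, the graph connectivity problem $C$ satisfies $$t(n,k+2)\le D_k(C,n)\le t(n,k+2)+n-1.$$
   Context: Problem $C$: the input is an unknown simple graph $G$ on a fixed set of $n$ labeled vertices; a query is a pair of vertices $\{u,v\}$ and its answer tells whether $uv$ is an edge of $G$; the goal is to determine whether $G$ is connected. $t(n,r)$ denotes the number of edges of the Turán graph $T(n,r)$, the complete $r$-partite graph on $n$ vertices whose parts have sizes $\lfloor n/r\rfloor$ or $\lceil n/r\rceil$ (equivalently, the maximum number of edges of an $r$-partite graph on $n$ vertices; if $r\ge n$ this is $\binom{n}{2}$). For an integer $k\ge 0$, $D_k(P,n)$ of a query problem $P$ is defined by the following game. The Adversary first chooses an input. The Questioner, who at every moment knows the current input, asks allowed queries one at a time. Before answering a query, the Adversary may replace the current input by any input consistent with all answers given so far (those answers stay fixed), at most $k$ times in total; queries are answered according to the current input. The game ends when all inputs consistent with the answers so far give the same output. $D_k(P,n)$ is the number of queries asked when the Questioner minimizes and the Adversary maximizes this number. -}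

module Defs where

open import Data.Nat using (ℕ; zero; suc; _+_; _*_; _∸_; _≤_; NonZero)
open import Data.Nat.DivMod using (_/_; _%_)
open import Data.Bool using (Bool; true; false)
open import Data.Fin using (Fin)
open import Data.List using (List; []; _∷_; replicate; _++_)
open import Data.Nat.ListAction using (sum)
open import Data.List.Relation.Unary.All using (All)
open import Data.Product using (_×_; _,_)
open import Relation.Binary.PropositionalEquality using (_≡_; _≢_)
open import Function.Bundles using (_⇔_)

record Graph (n : ℕ) : Set where
  field
    adj    : Fin n → Fin n → Bool
    sym    : ∀ u v → adj u v ≡ adj v u
    irrefl : ∀ u → adj u u ≡ false
open Graph public

data Reach {n : ℕ} (G : Graph n) : Fin n → Fin n → Set where
  here : ∀ {u} → Reach G u u
  step : ∀ {u w v} → adj G u w ≡ true → Reach G w v → Reach G u v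

Connected : ∀ {n} → Graph n → Set
Connected G = ∀ u v → Reach G u v

Answer : ℕ → Set
Answer n = Fin n × Fin n × Bool

Answers : ℕ → Set
Answers n = List (Answer n)

answerOf : ∀ {n} → Fin n → Fin n → Graph n → Answer n
answerOf u v G = u , v , adj G u v

Agrees : ∀ {n} → Graph n → Answer n → Set
Agrees G (u , v , b) = adj G u v ≡ b

Consistent : ∀ {n} → Graph n → Answers n → Set
Consistent G A = All (Agrees G) A

Settled : ∀ {n} → Answers n → Set
Settled {n} A = ∀ (G H : Graph n) → Consistent G A → Consistent H A →
                (Connected G ⇔ Connected H)

-- The game defining D_k(C,n).
-- QWin A G j m : from the position where the answers so far are A, the
-- current input is G and the Adversary has j changes left, the
-- Questioner (who knows A, G, j) can force the game to end after at
-- most m further queries, whatever the Adversary does.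

data QWin {n : ℕ} : Answers n → Graph n → ℕ → ℕ → Set where
  done : ∀ {A G j m} → Settled A → QWin A G j m
  ask  : ∀ {A G j m} (u v : Fin n) → u ≢ v →
         -- Adversary keeps the current input
         QWin (answerOf u v G ∷ A) G j m →
         -- Adversary replaces the current input by a consistent H
         (∀ j′ → j ≡ suc j′ → ∀ (H : Graph n) → Consistent H A →
            QWin (answerOf u v H ∷ A) H j′ m) →
         QWin A G j (suc m)

-- "D_k(C,n) ≤ m": whatever initial input the Adversary chooses, the
-- Questioner can finish within m queries.
D≤ : ℕ → ℕ → ℕ → Set
D≤ k n m = ∀ (G : Graph n) → QWin [] G k m

-- Turán number t(n,r): edges of the complete r-partite graph whose parts
-- have sizes ⌊n/r⌋ or ⌈n/r⌉.

turanParts : (n r : ℕ) → .{{NonZero r}} → List ℕ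
turanParts n r = replicate (n % r) (suc (n / r)) ++ replicate (r ∸ n % r) (n / r)

-- edges of the complete multipartite graph with the given part sizes
pairProducts : List ℕ → ℕ
pairProducts []       = 0
pairProducts (x ∷ xs) = x * sum xs + pairProducts xs

turan : (n r : ℕ) → .{{NonZero r}} → ℕ
turan n r = pairProducts (turanParts n r)

{-# OPTIONS --safe #-}
-- Lower bound: the Adversary starts with the disjoint cliques on the parts of
-- the Turán graph T(n,k+2) and answers "no" across parts, except that while
-- changes remain the last unasked pair between two current classes becomes an
-- edge and the two classes are merged. Two classes are always linked by an
-- unasked pair, so the game cannot end before every Turán edge has been asked.
--
-- Upper bound: the Questioner grows the set Y known to be connected to a fixed
-- root, asking an edge of the current graph that leaves Y if there is one and
-- otherwise a pair across Y. There are at most n - 1 "yes" answers. Grouping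
-- the vertices into layers, a new one for the first "no" after each change
-- (and for the initial graph), makes the "no" pairs (k+2)-partite.

module Submission where

open import Defs renaming (sym to adj-sym)
open import Data.Bool using (Bool; true; false; not; _∧_; _∨_)
import Data.Bool.Properties as Bool
open import Data.Bool.Properties using (¬-not)
open import Data.Fin using (Fin; zero; suc; fromℕ<; punchOut)
open import Data.Fin.Properties using (_≟_; any?; suc-injective; fromℕ<-injective; punchOut-cong; punchOut-injective)
open import Data.List using (List; []; _∷_; _++_; length; replicate)
open import Data.List.Properties using (++-identityʳ)
open import Data.List.Relation.Unary.All using ([]; _∷_)
import Data.Nat as ℕ
open import Data.Nat using (ℕ; zero; suc; _+_; _*_; _∸_; _≤_; _<_; z≤n; s≤s; NonZero; _≤?_)
open import Data.Nat.Divisibility using (n∣m*n)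
open import Data.Nat.DivMod
open import Data.Nat.ListAction using (sum)
open import Data.Nat.Properties hiding (_≟_; suc-injective)
open import Data.Nat.Solver using (module +-*-Solver)
open import Data.Product using (∃; ∃₂; _×_; _,_; proj₁; proj₂)
open import Data.Sum using (_⊎_; inj₁; inj₂)
import Data.Vec as Vec
open import Data.Vec using (Vec; []; _∷_; lookup; updateAt; toList)
open import Data.Vec.Properties using (lookup-replicate; lookup∘updateAt; lookup∘updateAt′; length-toList)
open import Function using (_∘_; case_of_; mk⇔; Equivalence)
open import Relation.Binary.PropositionalEquality
open import Relation.Nullary using (¬_; Dec; yes; no; does; contradiction; ¬?)
open import Relation.Nullary.Decidable using (dec-true; dec-false; does-⇔; _×-dec_; _⊎-dec_)

-- Counting vertices and unordered pairs

does⇒ : ∀ {A : Set} (a? : Dec A) → does a? ≡ true → A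
does⇒ (yes a) _ = a

true≢false : ∀ {b} → b ≡ true → b ≢ false
true≢false refl ()

private variable
  n r : ℕ

indicator : Bool → ℕ
indicator true  = 1
indicator false = 0

indicator-mono : ∀ {b c} → (b ≡ true → c ≡ true) → indicator b ≤ indicator c
indicator-mono {false} _ = z≤n
indicator-mono {true}  f rewrite f refl = ≤-refl

count : (Fin n → Bool) → ℕ
count {zero}  P = 0
count {suc n} P = indicator (P zero) + count (P ∘ suc)

-- `P` is evaluated only at increasing pairs of arguments, so for a symmetric `P` each unordered
-- pair counts once.
pairs : (Fin n → Fin n → Bool) → ℕ
pairs {zero}  P = 0
pairs {suc n} P = count (P zero ∘ suc) + pairs (λ u v → P (suc u) (suc v))

count-mono : {P Q : Fin n → Bool} → (∀ i → P i ≡ true → Q i ≡ true) → count P ≤ count Q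
count-mono {zero}  h = z≤n
count-mono {suc n} h = +-mono-≤ (indicator-mono (h zero)) (count-mono (h ∘ suc))

count-cong : {P Q : Fin n → Bool} → (∀ i → P i ≡ Q i) → count P ≡ count Q
count-cong {zero}  h = refl
count-cong {suc n} h = cong₂ _+_ (cong indicator (h zero)) (count-cong (h ∘ suc))

count-none : {P : Fin n → Bool} → (∀ i → P i ≡ false) → count P ≡ 0
count-none {zero}  h = refl
count-none {suc n} h rewrite h zero = count-none (h ∘ suc)

count-all : {P : Fin n → Bool} → (∀ i → P i ≡ true) → count P ≡ n
count-all {zero}  h = refl
count-all {suc n} h rewrite h zero = cong suc (count-all (h ∘ suc))

count-insert : {P Q : Fin n → Bool} (a : Fin n) → P a ≡ false → Q a ≡ true →
               (∀ i → i ≢ a → P i ≡ Q i) → count Q ≡ suc (count P)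
count-insert zero p q h rewrite p | q = cong suc (sym (count-cong (λ i → h (suc i) λ ())))
count-insert {suc n} {P} {Q} (suc a) p q h = begin
  indicator (Q zero) + count (Q ∘ suc)       ≡⟨ cong₂ _+_ (cong indicator (sym (h zero λ ())))
                                                          (count-insert a p q (λ i i≢a → h (suc i) (i≢a ∘ suc-injective))) ⟩
  indicator (P zero) + suc (count (P ∘ suc)) ≡⟨ +-suc _ _ ⟩
  suc (count P)                              ∎
  where open ≡-Reasoning

pairs-mono : {P Q : Fin n → Fin n → Bool} → (∀ u v → P u v ≡ true → Q u v ≡ true) → pairs P ≤ pairs Q
pairs-mono {zero}  h = z≤n
pairs-mono {suc n} h = +-mono-≤ (count-mono (h zero ∘ suc)) (pairs-mono (λ u v → h (suc u) (suc v)))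

pairs-cong : {P Q : Fin n → Fin n → Bool} → (∀ u v → P u v ≡ Q u v) → pairs P ≡ pairs Q
pairs-cong {zero}  h = refl
pairs-cong {suc n} h = cong₂ _+_ (count-cong (h zero ∘ suc)) (pairs-cong (λ u v → h (suc u) (suc v)))

pairs-none : {P : Fin n → Fin n → Bool} → (∀ u v → P u v ≡ false) → pairs P ≡ 0
pairs-none {zero}  h = refl
pairs-none {suc n} h = cong₂ _+_ (count-none (h zero ∘ suc)) (pairs-none (λ u v → h (suc u) (suc v)))

-- Inserting and removing one unordered pair

SamePair : (a b u v : Fin n) → Set
SamePair a b u v = (u ≡ a × v ≡ b) ⊎ (u ≡ b × v ≡ a)

samePair? : (a b u v : Fin n) → Dec (SamePair a b u v)
samePair? a b u v = (u ≟ a ×-dec v ≟ b) ⊎-dec (u ≟ b ×-dec v ≟ a)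

samePair-swap : {a b u v : Fin n} → SamePair a b u v → SamePair a b v u
samePair-swap (inj₁ (p , q)) = inj₂ (q , p)
samePair-swap (inj₂ (p , q)) = inj₁ (q , p)

samePair-suc : {a b u v : Fin n} → SamePair (suc a) (suc b) (suc u) (suc v) → SamePair a b u v
samePair-suc (inj₁ (refl , refl)) = inj₁ (refl , refl)
samePair-suc (inj₂ (refl , refl)) = inj₂ (refl , refl)

Symmetric : (Fin n → Fin n → Bool) → Set
Symmetric P = ∀ u v → P u v ≡ P v u

pairs-insert : {P Q : Fin n → Fin n → Bool} (a b : Fin n) → a ≢ b →
               Symmetric P → Symmetric Q → P a b ≡ false → Q a b ≡ true →
               (∀ u v → ¬ SamePair a b u v → P u v ≡ Q u v) →
               pairs Q ≡ suc (pairs P)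
pairs-insert zero zero a≢b _ _ _ _ _ = contradiction refl a≢b
pairs-insert zero (suc b) _ _ _ p q h =
  cong₂ _+_ (count-insert b p q (λ i i≢b → h zero (suc i) λ { (inj₁ (_ , refl)) → i≢b refl ; (inj₂ (() , _)) }))
            (sym (pairs-cong (λ u v → h (suc u) (suc v) λ { (inj₁ (() , _)) ; (inj₂ (_ , ())) })))
pairs-insert (suc a) zero a≢b sP sQ p q h =
  -- Only increasing arguments are counted, so symmetry carries the hypotheses over to the pair in
  -- the other order.
  pairs-insert zero (suc a) (a≢b ∘ sym) sP sQ (trans (sP _ _) p) (trans (sQ _ _) q)
               (λ u v ¬s → h u v λ { (inj₁ s) → ¬s (inj₂ s) ; (inj₂ s) → ¬s (inj₁ s) })
pairs-insert {suc n} {P} {Q} (suc a) (suc b) a≢b sP sQ p q h =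
  trans (cong₂ _+_ (sym (count-cong (λ i → h zero (suc i) λ { (inj₁ (() , _)) ; (inj₂ (() , _)) })))
                   (pairs-insert a b (a≢b ∘ cong suc) (λ u v → sP (suc u) (suc v)) (λ u v → sQ (suc u) (suc v)) p q
                                 (λ u v ¬s → h (suc u) (suc v) (¬s ∘ samePair-suc))))
        (+-suc (count (P zero ∘ suc)) _)

insertPair removePair : (a b : Fin n) → (Fin n → Fin n → Bool) → Fin n → Fin n → Bool
insertPair a b P u v = does (samePair? a b u v) ∨ P u v
removePair a b P u v = not (does (samePair? a b u v)) ∧ P u v

samePair-sym : (a b : Fin n) → Symmetric (λ u v → does (samePair? a b u v))
samePair-sym a b u v = does-⇔ (mk⇔ samePair-swap samePair-swap) (samePair? a b u v) (samePair? a b v u)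

insertPair-sym : {P : Fin n → Fin n → Bool} (a b : Fin n) → Symmetric P → Symmetric (insertPair a b P)
insertPair-sym a b sP u v = cong₂ _∨_ (samePair-sym a b u v) (sP u v)

removePair-sym : {P : Fin n → Fin n → Bool} (a b : Fin n) → Symmetric P → Symmetric (removePair a b P)
removePair-sym a b sP u v = cong₂ (λ x y → not x ∧ y) (samePair-sym a b u v) (sP u v)

insertPair-hit : {P : Fin n → Fin n → Bool} {a b u v : Fin n} → SamePair a b u v → insertPair a b P u v ≡ true
insertPair-hit {a = a} {b} {u} {v} s rewrite dec-true (samePair? a b u v) s = refl

insertPair-miss : {P : Fin n → Fin n → Bool} {a b u v : Fin n} → ¬ SamePair a b u v → insertPair a b P u v ≡ P u v
insertPair-miss {a = a} {b} {u} {v} ¬s rewrite dec-false (samePair? a b u v) ¬s = refl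

removePair-hit : {P : Fin n → Fin n → Bool} {a b u v : Fin n} → SamePair a b u v → removePair a b P u v ≡ false
removePair-hit {a = a} {b} {u} {v} s rewrite dec-true (samePair? a b u v) s = refl

removePair-miss : {P : Fin n → Fin n → Bool} {a b u v : Fin n} → ¬ SamePair a b u v → removePair a b P u v ≡ P u v
removePair-miss {a = a} {b} {u} {v} ¬s rewrite dec-false (samePair? a b u v) ¬s = refl

insertPair⁻ : {P : Fin n → Fin n → Bool} {a b u v : Fin n} →
              insertPair a b P u v ≡ true → SamePair a b u v ⊎ P u v ≡ true
insertPair⁻ {a = a} {b} {u} {v} e with does (samePair? a b u v) in eq
... | true  = inj₁ (does⇒ (samePair? a b u v) eq)
... | false = inj₂ e

removePair⁻ : {P : Fin n → Fin n → Bool} {a b u v : Fin n} →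
              removePair a b P u v ≡ true → ¬ SamePair a b u v × P u v ≡ true
removePair⁻ {a = a} {b} {u} {v} e with does (samePair? a b u v) in eq
... | false = (λ s → true≢false (dec-true (samePair? a b u v) s) eq) , e

pairs-insertPair : {P : Fin n → Fin n → Bool} {a b : Fin n} → a ≢ b → Symmetric P → P a b ≡ false →
                   pairs (insertPair a b P) ≡ suc (pairs P)
pairs-insertPair {P = P} {a} {b} a≢b sP p =
  pairs-insert a b a≢b sP (insertPair-sym a b sP) p (insertPair-hit {P = P} (inj₁ (refl , refl)))
               (λ u v ¬s → sym (insertPair-miss {P = P} ¬s))

pairs-removePair : {P : Fin n → Fin n → Bool} {a b : Fin n} → a ≢ b → Symmetric P → P a b ≡ true →
                   pairs P ≡ suc (pairs (removePair a b P))
pairs-removePair {P = P} {a} {b} a≢b sP p =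
  pairs-insert a b a≢b (removePair-sym a b sP) sP (removePair-hit {P = P} (inj₁ (refl , refl))) p
               (λ u v → removePair-miss {P = P})

-- Turán numbers

data Bump (x : ℕ) : List ℕ → List ℕ → Set where
  here  : ∀ {xs} → Bump x (x ∷ xs) (suc x ∷ xs)
  there : ∀ {y xs ys} → Bump x xs ys → Bump x (y ∷ xs) (y ∷ ys)

sum-bump : ∀ {x xs ys} → Bump x xs ys → sum ys ≡ suc (sum xs)
sum-bump here              = refl
sum-bump (there {y = y} b) = trans (cong (y +_) (sum-bump b)) (+-suc y _)

length-bump : ∀ {x xs ys} → Bump x xs ys → length ys ≡ length xs
length-bump here      = refl
length-bump (there b) = cong suc (length-bump b)

-- With the entries as part sizes, a vertex added to a part of size `x` gains `sum xs - x` edges;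
-- `x` stands on the left to avoid truncated subtraction. The Turán counts below all rest on this
-- identity.
pairProducts-bump : ∀ {x xs ys} → Bump x xs ys → pairProducts ys + x ≡ pairProducts xs + sum xs
pairProducts-bump {x} (here {xs}) =
  solve 3 (λ x s p → (s :+ x :* s :+ p) :+ x := (x :* s :+ p) :+ (x :+ s)) refl x (sum xs) (pairProducts xs)
  where open +-*-Solver
pairProducts-bump {x} (there {y} {xs} {ys} b) = begin
  (y * sum ys + pairProducts ys) + x               ≡⟨ +-assoc (y * sum ys) _ x ⟩
  y * sum ys + (pairProducts ys + x)               ≡⟨ cong₂ (λ s p → y * s + p) (sum-bump b) (pairProducts-bump b) ⟩
  y * suc (sum xs) + (pairProducts xs + sum xs)    ≡⟨ solve 3 (λ y s p → y :* (con 1 :+ s) :+ (p :+ s) := (y :* s :+ p) :+ (y :+ s))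
                                                            refl y (sum xs) (pairProducts xs) ⟩
  (y * sum xs + pairProducts xs) + (y + sum xs)    ∎
  where open ≡-Reasoning
        open +-*-Solver

-- `turanParts` with quotient and remainder set free, so that the remainder can be stepped without
-- redoing the division.
balanced : (r q s : ℕ) → List ℕ
balanced r q s = replicate s (suc q) ++ replicate (r ∸ s) q

bump-replicate : ∀ s d q → Bump q (replicate s (suc q) ++ replicate (suc d) q)
                                  (replicate (suc s) (suc q) ++ replicate d q)
bump-replicate zero    d q = here
bump-replicate (suc s) d q = there (bump-replicate s d q)

bump-balanced : ∀ {r q s} → s < r → Bump q (balanced r q s) (balanced r q (suc s))
bump-balanced {suc r} {q} {s} (s≤s s≤r) rewrite +-∸-assoc 1 s≤r = bump-replicate s (r ∸ s) q

sum-replicate : ∀ d x → sum (replicate d x) ≡ d * x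
sum-replicate zero    x = refl
sum-replicate (suc d) x = cong (x +_) (sum-replicate d x)

sum-balanced : ∀ {r q s} → s ≤ r → sum (balanced r q s) ≡ s + q * r
sum-balanced {r} {q} {zero}  _   = trans (sum-replicate r q) (*-comm r q)
sum-balanced {r} {q} {suc s} s<r =
  trans (sum-bump (bump-balanced s<r)) (cong suc (sum-balanced (<⇒≤ s<r)))

balanced-full : ∀ r q → balanced r q r ≡ balanced r (suc q) 0
balanced-full r q rewrite n∸n≡0 r = ++-identityʳ _

turan-balanced : ∀ r .{{_ : NonZero r}} {q s} → s < r → turan (s + q * r) r ≡ pairProducts (balanced r q s)
turan-balanced r {q} {s} s<r = cong₂ (λ q s → pairProducts (balanced r q s)) quot rem
  where
  quot : (s + q * r) / r ≡ q
  quot = trans (+-distrib-/-∣ʳ s (n∣m*n q)) (cong₂ _+_ (m<n⇒m/n≡0 s<r) (m*n/n≡m q r))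
  rem : (s + q * r) % r ≡ s
  rem = trans ([m+kn]%n≡m%n s q r) (m<n⇒m%n≡m s<r)

-- Stepping the remainder can reach `s ≡ r`; the list is then also the one with quotient `suc q` and
-- remainder 0.
turan-balanced-≤ : ∀ r .{{_ : NonZero r}} {q s} → s ≤ r → turan (s + q * r) r ≡ pairProducts (balanced r q s)
turan-balanced-≤ r@(suc _) {q} s≤r with m≤n⇒m<n∨m≡n s≤r
... | inj₁ s<r  = turan-balanced r s<r
... | inj₂ refl = trans (turan-balanced r {suc q} {0} (s≤s z≤n)) (cong pairProducts (sym (balanced-full r q)))

-- The new vertex joins a part of the smaller size `n / r` and so gains `n - n / r` edges.
turan-suc : ∀ n r .{{_ : NonZero r}} → turan (suc n) r + n / r ≡ turan n r + n
turan-suc n r = begin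
  turan (suc n) r + q                                       ≡⟨ cong (λ m → turan (suc m) r + q) n≡ ⟩
  turan (suc s + q * r) r + q                               ≡⟨ cong (_+ q) (turan-balanced-≤ r s<r) ⟩
  pairProducts (balanced r q (suc s)) + q                   ≡⟨ pairProducts-bump (bump-balanced s<r) ⟩
  pairProducts (balanced r q s) + sum (balanced r q s)      ≡⟨ cong (turan n r +_) (sum-balanced (<⇒≤ s<r)) ⟩
  turan n r + (s + q * r)                                   ≡⟨ cong (turan n r +_) (sym n≡) ⟩
  turan n r + n                                             ∎
  where
  open ≡-Reasoning
  q = n / r
  s = n % r
  s<r = m%n<n n r
  n≡ = m≡m%n+[m/n]*n n r

-- Pigeonhole: a head that is at most `q` leaves the excess to the tail. The witness is a `Bump`
-- ending in `xs`, so that removing a vertex is the reverse of adding one.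
large-part : ∀ q xs → length xs * q < sum xs → ∃₂ λ x ys → Bump x ys xs × q ≤ x
large-part q (x ∷ xs) lt with x ≤? q
large-part q (zero  ∷ xs) lt | no x≰q = contradiction z≤n x≰q
large-part q (suc x ∷ xs) lt | no x≰q = x , x ∷ xs , here , ≤-pred (≰⇒> x≰q)
large-part q (x ∷ xs)     lt | yes x≤q =
  let y , ys , b , q≤y = large-part q xs (+-cancelˡ-< x _ _ (≤-<-trans (+-monoˡ-≤ (length xs * q) x≤q) lt))
  in y , x ∷ ys , there b , q≤y

-- Induction on n, shrinking a part of more than n / r elements.
pairProducts≤turan : ∀ n xs r .{{_ : NonZero r}} → length xs ≡ r → sum xs ≡ n → pairProducts xs ≤ turan n r
pairProducts≤turan zero xs r _ eq = ≤-trans (≤-reflexive (pairProducts-zero xs eq)) z≤n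
  where
  pairProducts-zero : ∀ xs → sum xs ≡ 0 → pairProducts xs ≡ 0
  pairProducts-zero []          _ = refl
  pairProducts-zero (zero ∷ xs) e = pairProducts-zero xs e
pairProducts≤turan (suc n) xs r refl eq = let x , ys , b , q≤x = large-part (n / r) xs avg in
  +-cancelʳ-≤ x _ _ (begin
    pairProducts xs + x          ≡⟨ pairProducts-bump b ⟩
    pairProducts ys + sum ys     ≡⟨ cong (pairProducts ys +_) (sum-ys b) ⟩
    pairProducts ys + n          ≤⟨ +-monoˡ-≤ n (pairProducts≤turan n ys r (sym (length-bump b)) (sum-ys b)) ⟩
    turan n r + n                ≡⟨ turan-suc n r ⟨
    turan (suc n) r + n / r      ≤⟨ +-monoʳ-≤ (turan (suc n) r) q≤x ⟩
    turan (suc n) r + x          ∎)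
  where
  open ≤-Reasoning
  avg : length xs * (n / r) < sum xs
  avg rewrite eq | *-comm (length xs) (n / length xs) = s≤s (m/n*n≤m n r)
  sum-ys : ∀ {x ys} → Bump x ys xs → sum ys ≡ n
  sum-ys b = cong ℕ.pred (trans (sym (sum-bump b)) eq)

-- Counting the pairs that a colouring separates

crossing : (Fin n → Fin r) → Fin n → Fin n → Bool
crossing c u v = not (does (c u ≟ c v))

sizes : (Fin n → Fin r) → Vec ℕ r
sizes {zero}  c = Vec.replicate _ 0
sizes {suc n} c = updateAt (sizes (c ∘ suc)) (c zero) suc

bump-updateAt : (xs : Vec ℕ r) (i : Fin r) → Bump (lookup xs i) (toList xs) (toList (updateAt xs i suc))
bump-updateAt (x ∷ xs) zero    = here
bump-updateAt (x ∷ xs) (suc i) = there (bump-updateAt xs i)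

sum-sizes : (c : Fin n → Fin r) → sum (toList (sizes c)) ≡ n
sum-sizes {zero} {r} c = go r
  where
  go : ∀ r → sum (toList (Vec.replicate r 0)) ≡ 0
  go zero    = refl
  go (suc r) = go r
sum-sizes {suc n} c = trans (sum-bump (bump-updateAt (sizes (c ∘ suc)) (c zero))) (cong suc (sum-sizes (c ∘ suc)))

count-others : (c : Fin n → Fin r) (a : Fin r) → count (λ v → not (does (a ≟ c v))) + lookup (sizes c) a ≡ n
count-others {zero}  c a = lookup-replicate a 0
count-others {suc n} c a with a ≟ c zero
... | yes refl rewrite lookup∘updateAt (c zero) {suc} (sizes (c ∘ suc)) = trans (+-suc _ _) (cong suc (count-others (c ∘ suc) a))
... | no a≢ rewrite lookup∘updateAt′ a (c zero) {suc} a≢ (sizes (c ∘ suc)) = cong suc (count-others (c ∘ suc) a)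

-- Vertex `zero` is separated from exactly the vertices outside its class, which is the gain in
-- `pairProducts-bump`; `x` is added on both sides to match that identity.
pairs-crossing : (c : Fin n → Fin r) → pairs (crossing c) ≡ pairProducts (toList (sizes c))
pairs-crossing {zero} {r} c = sym (go r)
  where
  go : ∀ r → pairProducts (toList (Vec.replicate r 0)) ≡ 0
  go zero    = refl
  go (suc r) = go r
pairs-crossing {suc n} c = +-cancelʳ-≡ x _ _ (begin
  (count (crossing c zero ∘ suc) + pairs (crossing (c ∘ suc))) + x ≡⟨ cong (_+ x) (+-comm (count (crossing c zero ∘ suc)) _) ⟩
  (pairs (crossing (c ∘ suc)) + count (crossing c zero ∘ suc)) + x ≡⟨ +-assoc (pairs (crossing (c ∘ suc))) _ x ⟩
  pairs (crossing (c ∘ suc)) + (count (crossing c zero ∘ suc) + x) ≡⟨ cong₂ _+_ (pairs-crossing (c ∘ suc)) (count-others (c ∘ suc) (c zero)) ⟩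
  pairProducts (toList xs) + n                                     ≡⟨ cong (pairProducts (toList xs) +_) (sum-sizes (c ∘ suc)) ⟨
  pairProducts (toList xs) + sum (toList xs)                       ≡⟨ pairProducts-bump (bump-updateAt xs (c zero)) ⟨
  pairProducts (toList (sizes c)) + x                              ∎)
  where
  open ≡-Reasoning
  xs = sizes (c ∘ suc)
  x = lookup xs (c zero)

pairs-crossing≤turan : .{{_ : NonZero r}} (c : Fin n → Fin r) → pairs (crossing c) ≤ turan n r
pairs-crossing≤turan {r} {n} c = ≤-trans (≤-reflexive (pairs-crossing c))
  (pairProducts≤turan n (toList (sizes c)) r (length-toList (sizes c)) (sum-sizes c))

-- The opposite pigeonhole: a head above `q` takes at least `suc q` of the total, so the tail
-- remains below its own bound.
small-part : ∀ q (xs : Vec ℕ r) → sum (toList xs) < r * suc q → ∃ λ i → lookup xs i ≤ q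
small-part q (x ∷ xs) lt with x ≤? q
... | yes x≤q = zero , x≤q
... | no x≰q =
  let i , le = small-part q xs (+-cancelˡ-< (suc q) _ _ (≤-<-trans (+-monoˡ-≤ _ (≰⇒> x≰q)) lt))
  in suc i , le

-- Greedily, each new vertex goes into a part of at most n / r elements.
turan-labelling : ∀ n r .{{_ : NonZero r}} → ∃ λ (c : Fin n → Fin r) → turan n r ≤ pairs (crossing c)
turan-labelling zero    r = (λ ()) , ≤-reflexive turan-0
  where
  zeros : ∀ d → pairProducts (replicate d 0) ≡ 0
  zeros zero    = refl
  zeros (suc d) = zeros d
  turan-0 : turan 0 r ≡ 0
  turan-0 = trans (turan-balanced-≤ r {0} z≤n) (zeros r)
turan-labelling (suc n) r =
  let c , t≤ = turan-labelling n r
      i , x≤ = small-part (n / r) (sizes c) (avg c)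
      c′ = λ { zero → i ; (suc v) → c v }
      x = lookup (sizes c) i
  in c′ , +-cancelʳ-≤ x _ _ (begin
    turan (suc n) r + x                          ≤⟨ +-monoʳ-≤ (turan (suc n) r) x≤ ⟩
    turan (suc n) r + n / r                      ≡⟨ turan-suc n r ⟩
    turan n r + n                                ≤⟨ +-monoˡ-≤ n t≤ ⟩
    pairs (crossing c) + n                       ≡⟨ cong₂ _+_ (pairs-crossing c) (sym (sum-sizes c)) ⟩
    pairProducts (toList (sizes c)) + sum (toList (sizes c)) ≡⟨ pairProducts-bump (bump-updateAt (sizes c) i) ⟨
    pairProducts (toList (sizes c′)) + x         ≡⟨ cong (_+ x) (pairs-crossing c′) ⟨
    pairs (crossing c′) + x                      ∎)
  where
  open ≤-Reasoning
  avg : ∀ c → sum (toList (sizes c)) < r * suc (n / r)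
  avg c = begin-strict
    sum (toList (sizes c))  ≡⟨ sum-sizes c ⟩
    n                       ≡⟨ m≡m%n+[m/n]*n n r ⟩
    n % r + n / r * r       <⟨ +-monoˡ-< (n / r * r) (m%n<n n r) ⟩
    r + n / r * r           ≡⟨ *-comm (suc (n / r)) r ⟩
    r * suc (n / r)         ∎

-- The Adversary

reach-trans : {G : Graph n} {u v w : Fin n} → Reach G u v → Reach G v w → Reach G u w
reach-trans here       q = q
reach-trans (step e p) q = step e (reach-trans p q)

reach-sym : {G : Graph n} {u v : Fin n} → Reach G u v → Reach G v u
reach-sym         here       = here
reach-sym {G = G} (step e p) = reach-trans (reach-sym p) (step (trans (adj-sym G _ _) e) here)

reach-mono : {G H : Graph n} → (∀ u v → adj G u v ≡ true → adj H u v ≡ true) →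
             ∀ {u v} → Reach G u v → Reach H u v
reach-mono le here       = here
reach-mono le (step e p) = step (le _ _ e) (reach-mono le p)

-- `q` is redirected to `p`, and the value `q`, no longer taken, is punched out. The last component
-- says that nothing else is identified.
merge : (p q : Fin (suc r)) → p ≢ q →
        ∃ λ (f : Fin (suc r) → Fin r) → f p ≡ f q ×
          (∀ x y → f x ≡ f y → x ≡ y ⊎ SamePair p q x y)
merge {r} p q p≢q = f , punchOut-cong q (trans (g≡p p (inj₁ refl)) (sym (g≡p q (inj₂ refl)))) , inj
  where
  -- Each value comes with the reason for it, so that `inj` can split on the reasons.
  redirect : ∀ x → Dec (x ≡ q) → ∃ λ y → q ≢ y × ((x ≡ q × y ≡ p) ⊎ y ≡ x)
  redirect x (yes x≡q) = p , p≢q ∘ sym , inj₁ (x≡q , refl)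
  redirect x (no x≢q)  = x , x≢q ∘ sym , inj₂ refl

  g : ∀ x → ∃ λ y → q ≢ y × ((x ≡ q × y ≡ p) ⊎ y ≡ x)
  g x = redirect x (x ≟ q)

  f : Fin (suc r) → Fin r
  f x = punchOut (proj₁ (proj₂ (g x)))

  g≡p : ∀ x → x ≡ p ⊎ x ≡ q → proj₁ (g x) ≡ p
  g≡p x x≡ with g x
  ... | y , q≢y , inj₁ (_ , y≡p) = y≡p
  g≡p x (inj₁ x≡p) | y , q≢y , inj₂ y≡x = trans y≡x x≡p
  g≡p x (inj₂ x≡q) | y , q≢y , inj₂ y≡x = contradiction (sym (trans y≡x x≡q)) q≢y

  inj : ∀ x y → f x ≡ f y → x ≡ y ⊎ SamePair p q x y
  inj x y e with g x | g y
  ... | a , q≢a , s | b , q≢b , t with punchOut-injective q≢a q≢b e | s | t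
  ... | refl | inj₁ (x≡q , a≡p) | inj₁ (y≡q , _)   = inj₁ (trans x≡q (sym y≡q))
  ... | refl | inj₁ (x≡q , a≡p) | inj₂ a≡y         = inj₂ (inj₂ (x≡q , trans (sym a≡y) a≡p))
  ... | refl | inj₂ a≡x         | inj₁ (y≡q , a≡p) = inj₂ (inj₁ (trans (sym a≡x) a≡p , y≡q))
  ... | refl | inj₂ a≡x         | inj₂ a≡y         = inj₁ (trans (sym a≡x) a≡y)

addEdges : (G : Graph n) (F : Fin n → Fin n → Bool) → Symmetric F → (∀ u → F u u ≡ false) → Graph n
addEdges G F F-sym F-irrefl = record
  { adj    = λ u v → F u v ∨ adj G u v
  ; sym    = λ u v → cong₂ _∨_ (F-sym u v) (adj-sym G u v)
  ; irrefl = λ u → cong₂ _∨_ (F-irrefl u) (irrefl G u)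
  }

∨-true-left : ∀ {x y} → x ≡ true → x ∨ y ≡ true
∨-true-left refl = refl

∨-true-right : ∀ {x y} → y ≡ true → x ∨ y ≡ true
∨-true-right {true}  refl = refl
∨-true-right {false} refl = refl

-- F is the set of pairs still free to be answered either way; the classes of
-- c are the components of G.
record Position {n j : ℕ} (A : Answers n) (G : Graph n) (c : Fin n → Fin (2 + j)) (F : Fin n → Fin n → Bool) : Set where
  field
    F-sym  : Symmetric F
    -- The answers given so far enter only in this form: changing `G` on pairs of `F` contradicts
    -- none of them.
    F-free : ∀ H → (∀ u v → F u v ≡ false → adj H u v ≡ adj G u v) → Consistent H A
    F-cross : ∀ {u v} → F u v ≡ true → c u ≢ c v
    F-links : ∀ {u v} → c u ≢ c v → ∃₂ λ a b → c a ≡ c u × c b ≡ c v × F a b ≡ true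
    apart  : ∀ {u v} → c u ≢ c v → adj G u v ≡ false
    joined : ∀ {u v} → c u ≡ c v → Reach G u v

  F-irrefl : ∀ u → F u u ≡ false
  F-irrefl u = ¬-not (λ e → F-cross e refl)

  reach-label : ∀ {u v} → Reach G u v → c u ≡ c v
  reach-label here = refl
  reach-label {u} (step {w = w} e p) with c u ≟ c w
  ... | yes eq = trans eq (reach-label p)
  ... | no neq = contradiction (apart neq) (true≢false e)

  full : Graph n
  full = addEdges G F F-sym F-irrefl

  full-consistent : Consistent full A
  full-consistent = F-free full (λ u v e → cong (_∨ adj G u v) e)

  full-connected : Connected full
  full-connected u v with c u ≟ c v
  ... | yes eq = reach-mono (λ _ _ → ∨-true-right) (joined eq)
  ... | no neq = let a , b , ca , cb , e = F-links neq in
    reach-trans (reach-mono (λ _ _ → ∨-true-right) (joined (sym ca)))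
      (step (∨-true-left e) (reach-mono (λ _ _ → ∨-true-right) (joined cb)))

  -- Both `G` and `full` are consistent, and `full` is connected. If `A` is settled then so is `G`
  -- connected, and since labels are constant along its paths there is one class only, which leaves
  -- no room for a pair of `F`.
  settled⇒no-free-pair : Settled A → ∀ u v → F u v ≡ false
  settled⇒no-free-pair settled u v = ¬-not λ e →
    F-cross e (reach-label (Equivalence.to (settled full G full-consistent (F-free G (λ _ _ _ → refl))) full-connected u v))

-- Serves the end of the game: without changes left there are two labels, so all free pairs run
-- between the same two classes.
Fin2-pair : (p q x y : Fin 2) → p ≢ q → x ≢ y → SamePair p q x y
Fin2-pair zero       zero       _          _          p≢q _   = contradiction refl p≢q
Fin2-pair (suc zero) (suc zero) _          _          p≢q _   = contradiction refl p≢q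
Fin2-pair _          _          zero       zero       _   x≢y = contradiction refl x≢y
Fin2-pair _          _          (suc zero) (suc zero) _   x≢y = contradiction refl x≢y
Fin2-pair zero       (suc zero) zero       (suc zero) _   _   = inj₁ (refl , refl)
Fin2-pair zero       (suc zero) (suc zero) zero       _   _   = inj₂ (refl , refl)
Fin2-pair (suc zero) zero       zero       (suc zero) _   _   = inj₂ (refl , refl)
Fin2-pair (suc zero) zero       (suc zero) zero       _   _   = inj₁ (refl , refl)

-- Updating the Adversary's position after an answer

module _ {n j : ℕ} {A : Answers n} {G : Graph n} {c : Fin n → Fin (2 + j)} {F : Fin n → Fin n → Bool}
         (pos : Position A G c F) where
  open Position pos

  answer-fixed : ∀ {u v} → F u v ≡ false → Position (answerOf u v G ∷ A) G c F
  answer-fixed {u} {v} e = record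
    { F-sym = F-sym
    ; F-free = λ H agree → agree u v e ∷ F-free H agree
    ; F-cross = F-cross ; F-links = F-links ; apart = apart ; joined = joined }

  -- `Linked` fixes the order of the two classes, which suits a search; `LastPair` uses `SamePair`,
  -- the form in which `merge` reports a collision of labels.
  Linked LastPair : (u v : Fin n) → Set
  Linked   u v = ∃₂ λ a b → c a ≡ c u × c b ≡ c v × removePair u v F a b ≡ true
  LastPair u v = ∀ a b → removePair u v F a b ≡ true → ¬ SamePair (c u) (c v) (c a) (c b)

  linked? : ∀ u v → Dec (Linked u v)
  linked? u v = any? λ a → any? λ b → c a ≟ c u ×-dec c b ≟ c v ×-dec removePair u v F a b Bool.≟ true

  last-pair : ∀ {u v} → ¬ Linked u v → LastPair u v
  last-pair         ¬link a b e (inj₁ (ca , cb)) = ¬link (a , b , ca , cb , e)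
  last-pair {u} {v} ¬link a b e (inj₂ (ca , cb)) = ¬link (b , a , cb , ca , trans (removePair-sym u v F-sym b a) e)

  removePair-shrinks : ∀ {u v a b} → F a b ≡ false → removePair u v F a b ≡ false
  removePair-shrinks e = ¬-not (λ t → true≢false (proj₂ (removePair⁻ {P = F} t)) e)

  answer-no : ∀ {u v} → Linked u v → Position (answerOf u v G ∷ A) G c (removePair u v F)
  answer-no {u} {v} (a₀ , b₀ , ca₀ , cb₀ , e₀) = record
    { F-sym = removePair-sym u v F-sym
    ; F-free = λ H agree → agree u v (removePair-hit {P = F} (inj₁ (refl , refl)))
                         ∷ F-free H (λ a b e → agree a b (removePair-shrinks e))
    ; F-cross = λ e → F-cross (proj₂ (removePair⁻ {P = F} e))
    ; F-links = links
    ; apart = apart ; joined = joined }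
    where
    links : ∀ {x y} → c x ≢ c y → ∃₂ λ a b → c a ≡ c x × c b ≡ c y × removePair u v F a b ≡ true
    links ne with F-links ne
    ... | a , b , ca , cb , e with samePair? u v a b
    ... | no ¬s = a , b , ca , cb , trans (removePair-miss {P = F} ¬s) e
    -- The old link is the pair just asked; the other link between the same classes replaces it,
    -- reversed in the next case.
    ... | yes (inj₁ (refl , refl)) = a₀ , b₀ , trans ca₀ ca , trans cb₀ cb , e₀
    ... | yes (inj₂ (refl , refl)) = b₀ , a₀ , trans cb₀ ca , trans ca₀ cb , trans (removePair-sym u v F-sym b₀ a₀) e₀

  module _ {u v : Fin n} (u≢v : u ≢ v) where

    join : Graph n
    join = addEdges G (λ a b → does (samePair? u v a b)) (samePair-sym u v)
             (λ a → dec-false (samePair? u v a a) λ { (inj₁ (refl , eq)) → u≢v eq ; (inj₂ (refl , eq)) → u≢v (sym eq) })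

    join-hit : ∀ {a b} → SamePair u v a b → adj join a b ≡ true
    join-hit {a} {b} = insertPair-hit {P = adj G}

    join-miss : ∀ {a b} → ¬ SamePair u v a b → adj join a b ≡ adj G a b
    join-miss = insertPair-miss {P = adj G}

    join-off : F u v ≡ true → ∀ a b → F a b ≡ false → adj join a b ≡ adj G a b
    join-off Fuv a b e = join-miss λ { (inj₁ (refl , refl)) → true≢false Fuv e
                                     ; (inj₂ (refl , refl)) → true≢false (trans (F-sym v u) Fuv) e }

-- One change is spent and one label lost, so there are always two more labels than changes. As the
-- asked pair was the last between its classes, no free pair falls inside the merged class. A link
-- between labels that still differ cannot be the asked pair, so it survives.
answer-yes : ∀ {n j A G} {c : Fin n → Fin (3 + j)} {F} (pos : Position A G c F) {u v} (u≢v : u ≢ v) →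
             F u v ≡ true → LastPair pos u v →
             ∃ λ (c′ : Fin n → Fin (2 + j)) →
               Position (answerOf u v (join pos u≢v) ∷ A) (join pos u≢v) c′ (removePair u v F)
answer-yes {n} {j} {A} {G} {c} {F} pos {u} {v} u≢v Fuv last with merge (c u) (c v) (Position.F-cross pos Fuv)
... | f , f-eq , f-inj = c′ , record
  { F-sym = removePair-sym u v F-sym
  ; F-free = λ H agree → agree u v (removePair-hit {P = F} (inj₁ (refl , refl)))
                       ∷ F-free H (λ a b e → trans (agree a b (removePair-shrinks pos e)) (join-off pos u≢v Fuv a b e))
  ; F-cross = λ {a} {b} e eq → case f-inj _ _ eq of λ
      { (inj₁ same) → F-cross (proj₂ (removePair⁻ {P = F} e)) same
      ; (inj₂ s)    → last a b e s }
  ; F-links = λ ne → let a , b , ca , cb , e = F-links (ne ∘ cong f) in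
      a , b , cong f ca , cong f cb ,
      trans (removePair-miss {P = F} λ s → ne (trans (sym (cong f ca)) (trans (c′-eq s) (cong f cb)))) e
  ; apart = λ ne → trans (join-miss pos u≢v (ne ∘ c′-eq)) (apart (ne ∘ cong f))
  ; joined = λ eq → case f-inj _ _ eq of λ
      { (inj₁ same) → lift (joined same)
      ; (inj₂ (inj₁ (cu , cv))) → bridge cu (inj₁ (refl , refl)) cv
      ; (inj₂ (inj₂ (cv , cu))) → bridge cv (inj₂ (refl , refl)) cu }
  }
  where
  open Position pos
  H′ = join pos u≢v

  c′ : Fin n → Fin (2 + j)
  c′ = f ∘ c

  c′-eq : ∀ {a b} → SamePair u v a b → c′ a ≡ c′ b
  c′-eq (inj₁ (refl , refl)) = f-eq
  c′-eq (inj₂ (refl , refl)) = sym f-eq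

  lift : ∀ {a b} → Reach G a b → Reach H′ a b
  lift = reach-mono (λ _ _ → ∨-true-right)

  bridge : ∀ {x a b y} → c x ≡ c a → SamePair u v a b → c y ≡ c b → Reach H′ x y
  bridge xa ab yb = reach-trans (lift (joined xa)) (step (join-hit pos u≢v ab) (lift (joined (sym yb))))

-- Induction on the strategy: each query removes at most one pair from `F`, and the game ends only
-- when `F` is empty.
free-pairs≤ : ∀ {n j A G m} {c : Fin n → Fin (2 + j)} {F} → Position A G c F → QWin A G j m → pairs F ≤ m
free-pairs≤ pos (done settled) =
  ≤-trans (≤-reflexive (pairs-none (Position.settled⇒no-free-pair pos settled))) z≤n
free-pairs≤ {F = F} pos (ask u v u≢v keep change) with F u v in Fuv | linked? pos u v
... | false | _ = m≤n⇒m≤1+n (free-pairs≤ (answer-fixed pos Fuv) keep)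
... | true | yes link = begin
  pairs F                            ≡⟨ pairs-removePair u≢v (Position.F-sym pos) Fuv ⟩
  suc (pairs (removePair u v F))     ≤⟨ s≤s (free-pairs≤ (answer-no pos link) keep) ⟩
  suc _                              ∎
  where open ≤-Reasoning
-- With two labels, the last pair between two classes is the last free pair of all, and the present
-- query pays for it.
free-pairs≤ {j = zero} {c = c} {F} pos (ask u v u≢v keep change) | true | no ¬link = begin
  pairs F                            ≡⟨ pairs-removePair u≢v (Position.F-sym pos) Fuv ⟩
  suc (pairs (removePair u v F))     ≡⟨ cong suc (pairs-none λ a b → ¬-not λ e → last-pair pos ¬link a b e
                                          (Fin2-pair (c u) (c v) (c a) (c b) (Position.F-cross pos Fuv)
                                            (Position.F-cross pos (proj₂ (removePair⁻ {P = F} e))))) ⟩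
  1                                  ≤⟨ s≤s z≤n ⟩
  suc _                              ∎
  where open ≤-Reasoning
-- The Adversary switches to `join`, which is consistent because it differs from `G` only at the
-- free pair.
free-pairs≤ {j = suc j} {F = F} pos (ask u v u≢v keep change) | true | no ¬link = begin
  pairs F                            ≡⟨ pairs-removePair u≢v (Position.F-sym pos) Fuv ⟩
  suc (pairs (removePair u v F))     ≤⟨ s≤s (free-pairs≤ (proj₂ (answer-yes pos u≢v Fuv (last-pair pos ¬link)))
                                          (change j refl H′ (Position.F-free pos H′ (join-off pos u≢v Fuv)))) ⟩
  suc _                              ∎
  where
  open ≤-Reasoning
  H′ = join pos u≢v

lower-bound : ∀ n k m → D≤ k n m → turan n (2 + k) ≤ m
lower-bound n k m win with turan-labelling n (2 + k)
... | c , turan≤ = ≤-trans turan≤ (free-pairs≤ start (win G))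
  where
  adjacent? : ∀ u v → Dec (c u ≡ c v × u ≢ v)
  adjacent? u v = c u ≟ c v ×-dec ¬? (u ≟ v)

  swap : ∀ {u v} → c u ≡ c v × u ≢ v → c v ≡ c u × v ≢ u
  swap (p , q) = sym p , q ∘ sym

  G : Graph n
  G = record
    { adj    = λ u v → does (adjacent? u v)
    ; sym    = λ u v → does-⇔ (mk⇔ swap swap) (adjacent? u v) (adjacent? v u)
    ; irrefl = λ u → dec-false (adjacent? u u) (λ p → proj₂ p refl)
    }

  -- If `n < 2 + k`, some labels have no vertices; the conditions speak only of labels of vertices.
  start : Position [] G c (crossing c)
  start = record
    { F-sym   = λ u v → cong not (does-⇔ (mk⇔ sym sym) (c u ≟ c v) (c v ≟ c u))
    ; F-free  = λ _ _ → []
    ; F-cross = λ {u} {v} e eq → true≢false e (cong not (dec-true (c u ≟ c v) eq))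
    ; F-links = λ {u} {v} ne → u , v , refl , refl , cong not (dec-false (c u ≟ c v) ne)
    ; apart   = λ {u} {v} ne → dec-false (adjacent? u v) (ne ∘ proj₁)
    ; joined  = λ {u} {v} eq → joined u v eq (u ≟ v)
    }
    where
    joined : ∀ u v → c u ≡ c v → Dec (u ≡ v) → Reach G u v
    joined u v eq (yes refl) = here
    joined u v eq (no u≢v)   = step (dec-true (adjacent? u v) (eq , u≢v)) here

-- The Questioner

-- Opens layer `ℓ`: the Boolean is membership in `Y`, and only label 0, meaning no layer yet, is
-- overwritten.
raise : Bool → ℕ → ℕ → ℕ
raise true  zero    ℓ = ℓ
raise true  (suc x) ℓ = suc x
raise false x       ℓ = x

raise-cases : ∀ b x ℓ → raise b x ℓ ≡ x ⊎ (b ≡ true × x ≡ 0 × raise b x ℓ ≡ ℓ)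
raise-cases true  zero    ℓ = inj₂ (refl , refl , refl)
raise-cases true  (suc x) ℓ = inj₁ refl
raise-cases false x       ℓ = inj₁ refl

raise-true≢0 : ∀ {b} x {i} → b ≡ true → raise b x (suc i) ≢ 0
raise-true≢0 zero    refl ()
raise-true≢0 (suc x) refl ()

insert : Fin n → (Fin n → Bool) → Fin n → Bool
insert z Y w = does (w ≟ z) ∨ Y w

insert⁻ : {Y : Fin n → Bool} {z w : Fin n} → insert z Y w ≡ true → w ≡ z ⊎ Y w ≡ true
insert⁻ {z = z} {w} e with w ≟ z
... | yes eq = inj₁ eq
... | no _   = inj₂ e

count-outside-insert : {Y : Fin n → Bool} {z : Fin n} → Y z ≡ false →
                       count (not ∘ Y) ≡ suc (count (not ∘ insert z Y))
count-outside-insert {Y = Y} {z} e = count-insert z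
  (cong (λ b → not (b ∨ Y z)) (dec-true (z ≟ z) refl)) (cong not e)
  (λ w w≢z → cong (λ b → not (b ∨ Y w)) (dec-false (w ≟ z) w≢z))

count-positive : {P : Fin n → Bool} (i : Fin n) → P i ≡ true → 1 ≤ count P
count-positive zero    e rewrite e = s≤s z≤n
count-positive (suc i) e = m≤n⇒m≤o+n _ (count-positive i e)

closed⇒stays : {G : Graph n} {Y : Fin n → Bool} →
                     (∀ {u v} → Y u ≡ true → Y v ≡ false → adj G u v ≡ false) →
                     ∀ {u v} → Y u ≡ true → Reach G u v → Y v ≡ true
closed⇒stays closed Yu here = Yu
closed⇒stays {Y = Y} closed Yu (step {w = w} e p) with Y w in Yw
... | true  = closed⇒stays closed Yw p
... | false = contradiction (closed Yu Yw) (true≢false e)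

module Search (p k : ℕ) where

  V : Set
  V = Fin (suc p)

  -- The layers are numbered downwards, ℓ being a lower bound on the numbers in
  -- use; label 0 stands for the vertices that are not yet in any layer.
  record State (A : Answers (suc p)) (G : Graph (suc p))
               (Y : V → Bool) (c : V → ℕ) (N : V → V → Bool) (ℓ : ℕ) : Set where
    field
      consistent : Consistent G A
      Y-root     : Y zero ≡ true
      Y-reach    : ∀ H → Consistent H A → ∀ {w} → Y w ≡ true → Reach H zero w
      N-sym      : Symmetric N
      N-no       : ∀ H → Consistent H A → ∀ {u v} → N u v ≡ true → adj H u v ≡ false
      N-cross    : ∀ {u v} → N u v ≡ true → c u ≢ c v
      c-inside   : ∀ {w} → c w ≢ 0 → Y w ≡ true
      c-max      : ∀ w → c w ≤ suc k
      c-min      : ∀ {w} → c w ≢ 0 → ℓ ≤ c w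

    -- The labels 0 to `suc k` are `2 + k` colours, and `N-cross` makes them a proper colouring of
    -- `N`.
    N≤turan : pairs N ≤ turan (suc p) (2 + k)
    N≤turan = ≤-trans (pairs-mono λ u v e → cong not (dec-false (colour u ≟ colour v) (N-cross e ∘ fromℕ<-injective _ _ _ _)))
                      (pairs-crossing≤turan colour)
      where
      colour : V → Fin (2 + k)
      colour w = fromℕ< (s≤s (c-max w))

    outside-label : ∀ {w} → Y w ≡ false → c w ≡ 0
    outside-label {w} e with c w ℕ.≟ 0
    ... | yes c≡0 = c≡0
    ... | no  c≢0 = contradiction e (true≢false (c-inside c≢0))

  -- Updating the Questioner's state

  module _ {A G Y c N ℓ} (st : State A G Y c N ℓ) {H : Graph (suc p)} (cons : Consistent H A) where
    open State st

    -- `H` is whichever input gives the answer, kept or replaced, so one update serves both branches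
    -- of a query. The new vertex stays in no layer until the next one is opened.
    grow : ∀ {y z} → Y y ≡ true → adj H y z ≡ true →
           State (answerOf y z H ∷ A) H (insert z Y) c N ℓ
    grow {y} {z} Yy e = record
      { consistent = refl ∷ cons
      ; Y-root     = ∨-true-right Y-root
      ; Y-reach    = λ { K (a ∷ as) Yw → case insert⁻ {Y = Y} Yw of λ
          { (inj₁ refl) → reach-trans (Y-reach K as Yy) (step (trans a e) here)
          ; (inj₂ Yw)   → Y-reach K as Yw } }
      ; N-sym      = N-sym
      ; N-no       = λ { K (_ ∷ as) → N-no K as }
      ; N-cross    = N-cross
      ; c-inside   = λ c≢0 → ∨-true-right (c-inside c≢0)
      ; c-max      = c-max
      ; c-min      = c-min
      }

    refuse : ∀ {y z} → adj H y z ≡ false → c y ≢ c z →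
             State (answerOf y z H ∷ A) H Y c (insertPair y z N) ℓ
    refuse {y} {z} e ne = record
      { consistent = refl ∷ cons
      ; Y-root     = Y-root
      ; Y-reach    = λ { K (_ ∷ as) → Y-reach K as }
      ; N-sym      = insertPair-sym y z N-sym
      ; N-no       = λ { K (a ∷ as) Nuv → case insertPair⁻ {P = N} Nuv of λ
          { (inj₁ (inj₁ (refl , refl))) → trans a e
          ; (inj₁ (inj₂ (refl , refl))) → trans (adj-sym K _ _) (trans a e)
          ; (inj₂ Nuv)                  → N-no K as Nuv } }
      ; N-cross    = λ Nuv → case insertPair⁻ {P = N} Nuv of λ
          { (inj₁ (inj₁ (refl , refl))) → ne
          ; (inj₁ (inj₂ (refl , refl))) → ne ∘ sym
          ; (inj₂ Nuv)                  → N-cross Nuv }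
      ; c-inside   = c-inside
      ; c-max      = c-max
      ; c-min      = c-min
      }

  relabel : (V → Bool) → (V → ℕ) → ℕ → V → ℕ
  relabel Y c ℓ w = raise (Y w) (c w) ℓ

  -- Only the class of label 0 is split, and its part in `Y` gets a number below all those in use.
  -- The labelling is thus refined, and `N-cross` survives.
  new-layer : ∀ {A G Y c N i} → i ≤ k → State A G Y c N (2 + i) → State A G Y (relabel Y c (suc i)) N (suc i)
  new-layer {Y = Y} {c} {N} {i} i≤k st = record
    { consistent = consistent ; Y-root = Y-root ; Y-reach = Y-reach ; N-sym = N-sym ; N-no = N-no
    ; N-cross  = λ {u} {v} Nuv → cross u v (N-cross Nuv)
    ; c-inside = inside
    ; c-max    = max
    ; c-min    = min
    }
    where
    open State st

    cases : ∀ w → relabel Y c (suc i) w ≡ c w ⊎ (Y w ≡ true × c w ≡ 0 × relabel Y c (suc i) w ≡ suc i)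
    cases w = raise-cases (Y w) (c w) (suc i)

    old≢new : ∀ {w} → c w ≢ 0 → suc i ≢ c w
    old≢new c≢0 eq = <⇒≢ (c-min c≢0) eq

    cross : ∀ u v → c u ≢ c v → relabel Y c (suc i) u ≢ relabel Y c (suc i) v
    cross u v ne eq with cases u | cases v
    ... | inj₁ a           | inj₁ b           = ne (trans (sym a) (trans eq b))
    ... | inj₁ a           | inj₂ (_ , z , b) = old≢new (λ cu → ne (trans cu (sym z))) (trans (sym b) (trans (sym eq) a))
    ... | inj₂ (_ , z , a) | inj₁ b           = old≢new (λ cv → ne (trans z (sym cv))) (trans (sym a) (trans eq b))
    ... | inj₂ (_ , z , _) | inj₂ (_ , z′ , _) = ne (trans z (sym z′))

    inside : ∀ {w} → relabel Y c (suc i) w ≢ 0 → Y w ≡ true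
    inside {w} ne with cases w
    ... | inj₁ a           = c-inside (ne ∘ trans a)
    ... | inj₂ (Yw , _)    = Yw

    max : ∀ w → relabel Y c (suc i) w ≤ suc k
    max w with cases w
    ... | inj₁ a           = subst (_≤ suc k) (sym a) (c-max w)
    ... | inj₂ (_ , _ , a) = subst (_≤ suc k) (sym a) (s≤s i≤k)

    min : ∀ {w} → relabel Y c (suc i) w ≢ 0 → suc i ≤ relabel Y c (suc i) w
    min {w} ne with cases w
    ... | inj₁ a           = subst (suc i ≤_) (sym a) (<⇒≤ (c-min (ne ∘ trans a)))
    ... | inj₂ (_ , _ , a) = ≤-reflexive (sym a)

  -- Each "yes" moves a vertex into `Y` and each "no" adds a pair to `N`, so the queries still to
  -- come number at most the vertices outside `Y` plus what `N` lacks of the Turán number. `pairs N`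
  -- stands on the right to avoid subtraction.
  record Budget (m : ℕ) (Y : V → Bool) (N : V → V → Bool) : Set where
    constructor within
    field
      bound : count (not ∘ Y) + turan (suc p) (2 + k) ≤ m + pairs N

  budget-grow : ∀ {m Y N z} → Y z ≡ false → Budget (suc m) Y N → Budget m (insert z Y) N
  budget-grow {m} {Y} {N} {z} Yz (within b) rewrite count-outside-insert {Y = Y} {z} Yz = within (≤-pred b)

  budget-refuse : ∀ {m Y N y z} → y ≢ z → Symmetric N → N y z ≡ false →
                  Budget (suc m) Y N → Budget m Y (insertPair y z N)
  budget-refuse {m} {Y} {N} {y} {z} y≢z N-sym Nyz (within b) = within (begin
    count (not ∘ Y) + turan (suc p) (2 + k) ≤⟨ b ⟩
    suc (m + pairs N)                       ≡⟨ +-suc m (pairs N) ⟨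
    m + suc (pairs N)                       ≡⟨ cong (m +_) (pairs-insertPair y≢z N-sym Nyz) ⟨
    m + pairs (insertPair y z N)            ∎)
    where open ≤-Reasoning

  -- Excludes running out of queries: `N` never exceeds the Turán number, so a vertex outside `Y`
  -- forces `m` to be positive.
  budget-positive : ∀ {A G Y c N ℓ m z} → State A G Y c N ℓ → Y z ≡ false → Budget m Y N → 1 ≤ m
  budget-positive {Y = Y} {N = N} {m = m} {z} st Yz (within b) = +-cancelʳ-≤ (turan (suc p) (2 + k)) 1 m (begin
    1 + turan (suc p) (2 + k)               ≤⟨ +-monoˡ-≤ _ (count-positive {P = not ∘ Y} z (cong not Yz)) ⟩
    count (not ∘ Y) + turan (suc p) (2 + k) ≤⟨ b ⟩
    m + pairs N                             ≤⟨ +-monoʳ-≤ m (State.N≤turan st) ⟩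
    m + turan (suc p) (2 + k)               ∎)
    where open ≤-Reasoning

  boundary≢ : ∀ {Y : V → Bool} {y z} → Y y ≡ true → Y z ≡ false → y ≢ z
  boundary≢ Yy Yz refl = true≢false Yy Yz

  boundary-label : ∀ {A G Y c N ℓ} → State A G Y c N ℓ → (∀ {w} → Y w ≡ true → c w ≢ 0) →
                   ∀ {y z} → Y y ≡ true → Y z ≡ false → c y ≢ c z
  boundary-label st labelled Yy Yz eq = labelled Yy (trans eq (State.outside-label st Yz))

  settled-connected : ∀ {A G Y c N ℓ} → State A G Y c N ℓ → (∀ w → Y w ≡ true) → Settled A
  settled-connected st all H K consH consK = mk⇔ (λ _ → connected K consK) (λ _ → connected H consH)
    where
    connected : ∀ H → Consistent H _ → Connected H
    connected H cons u v = reach-trans (reach-sym (State.Y-reach st H cons (all u))) (State.Y-reach st H cons (all v))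

  settled-disconnected : ∀ {A G Y c N ℓ z} → State A G Y c N ℓ → Y z ≡ false →
                         (∀ {u v} → Y u ≡ true → Y v ≡ false → N u v ≡ true) → Settled A
  settled-disconnected {Y = Y} {z = z} st Yz cut H K consH consK =
    mk⇔ (λ conn → contradiction conn (disconnected H consH)) (λ conn → contradiction conn (disconnected K consK))
    where
    disconnected : ∀ H → Consistent H _ → ¬ Connected H
    disconnected H cons conn = true≢false
      (closed⇒stays {Y = Y} (λ Yu Yv → State.N-no st H cons (cut Yu Yv)) (State.Y-root st) (conn zero z)) Yz

  -- Layer 1 + j is still unused when explore has j changes left, and in use in
  -- separate; a change in either phase restores the invariant of explore.
  mutual
    explore : ∀ m {A G j Y c N} → j ≤ k → State A G Y c N (2 + j) → Budget m Y N → QWin A G j m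
    explore m {G = G} {Y = Y} j≤k st b with any? (λ z → Y z Bool.≟ false)
    ... | no ¬z = done (settled-connected st (λ w → ¬-not (λ e → ¬z (w , e))))
    ... | yes (z₀ , Yz₀) with any? (λ y → any? (λ z → Y y Bool.≟ true ×-dec Y z Bool.≟ false ×-dec adj G y z Bool.≟ true))
    -- No edge of `G` leaves `Y`, so "no" answers begin. Opening a layer first gives every vertex of
    -- `Y` a nonzero label, unlike the vertices outside.
    ...   | no ¬e = separate m j≤k (new-layer j≤k st) (raise-true≢0 _)
                      (λ {u} {v} Yu Yv → ¬-not (λ e → ¬e (u , v , Yu , Yv , e))) Yz₀ b
    explore zero    j≤k st b | yes (z₀ , Yz₀) | yes _ = contradiction (budget-positive st Yz₀ b) λ ()
    explore (suc m) {A} {G} {j} {Y} {c} {N} j≤k st b | yes _ | yes (y , z , Yy , Yz , e) =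
      ask y z (boundary≢ {Y} Yy Yz) (explore m j≤k (grow st (State.consistent st) Yy e) (budget-grow Yz b))
          (respond m j≤k (new-layer j≤k st) (raise-true≢0 _) Yy Yz
                   (¬-not (λ Nyz → true≢false e (State.N-no st G (State.consistent st) Nyz))) b)

    separate : ∀ m {A G j Y c N z} → j ≤ k → State A G Y c N (1 + j) → (∀ {w} → Y w ≡ true → c w ≢ 0) →
               (∀ {u v} → Y u ≡ true → Y v ≡ false → adj G u v ≡ false) → Y z ≡ false →
               Budget m Y N → QWin A G j m
    separate m {Y = Y} {N = N} j≤k st labelled closed Yz₀ b
      with any? (λ y → any? (λ z → Y y Bool.≟ true ×-dec Y z Bool.≟ false ×-dec N y z Bool.≟ false))
    ... | no ¬e = done (settled-disconnected st Yz₀ (λ {u} {v} Yu Yv → ¬-not (λ e → ¬e (u , v , Yu , Yv , e))))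
    separate zero    j≤k st labelled closed Yz₀ b | yes _ = contradiction (budget-positive st Yz₀ b) λ ()
    separate (suc m) {Y = Y} j≤k st labelled closed Yz₀ b | yes (y , z , Yy , Yz , Nyz) =
      ask y z y≢z (separate m j≤k (refuse st (State.consistent st) (closed Yy Yz) (boundary-label st labelled Yy Yz))
                            labelled closed Yz₀ (budget-refuse y≢z (State.N-sym st) Nyz b))
          (respond m j≤k st labelled Yy Yz Nyz b)
      where y≢z = boundary≢ {Y} Yy Yz

    respond : ∀ m {A G j Y c N y z} → j ≤ k → State A G Y c N (1 + j) → (∀ {w} → Y w ≡ true → c w ≢ 0) →
              Y y ≡ true → Y z ≡ false → N y z ≡ false → Budget (suc m) Y N →
              ∀ j′ → j ≡ suc j′ → ∀ H → Consistent H A → QWin (answerOf y z H ∷ A) H j′ m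
    respond m {Y = Y} {N = N} {y} {z} j≤k st labelled Yy Yz Nyz b j′ refl H cons with adj H y z Bool.≟ true
    -- With `j` equal to `suc j′`, the bound `1 + j` on the layer numbers is the `2 + j′` that
    -- `explore` requires.
    ... | yes e = explore m (<⇒≤ j≤k) (grow st cons Yy e) (budget-grow Yz b)
    ... | no ¬e = explore m (<⇒≤ j≤k) (refuse st cons (¬-not ¬e) (boundary-label st labelled Yy Yz))
                          (budget-refuse (boundary≢ {Y} Yy Yz) (State.N-sym st) Nyz b)

  upper-bound : D≤ k (suc p) (turan (suc p) (2 + k) + p)
  upper-bound G = explore _ ≤-refl start (within (≤-reflexive budget))
    where
    root : V → Bool
    root zero    = true
    root (suc _) = false

    -- No layer is in use; `2 + k` lies just above `suc k`, the number that the first layer will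
    -- get.
    start : State [] G root (λ _ → 0) (λ _ _ → false) (2 + k)
    start = record
      { consistent = []
      ; Y-root     = refl
      ; Y-reach    = λ { H _ {zero} _ → here }
      ; N-sym      = λ _ _ → refl
      ; N-no       = λ _ _ ()
      ; N-cross    = λ ()
      ; c-inside   = λ 0≢0 → contradiction refl 0≢0
      ; c-max      = λ _ → z≤n
      ; c-min      = λ 0≢0 → contradiction refl 0≢0
      }

    t = turan (suc p) (2 + k)

    budget : count (not ∘ root) + t ≡ t + p + pairs {suc p} (λ _ _ → false)
    budget = begin
      count (not ∘ root) + t                 ≡⟨ cong (_+ t) (count-all (λ _ → refl)) ⟩
      p + t                                  ≡⟨ +-comm p t ⟩
      t + p                                  ≡⟨ +-identityʳ (t + p) ⟨
      t + p + 0                              ≡⟨ cong (t + p +_) (pairs-none {suc p} (λ _ _ → refl)) ⟨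
      t + p + pairs {suc p} (λ _ _ → false)  ∎
      where open ≡-Reasoning

theorem6 : ∀ (n : ℕ) → 1 ≤ n → ∀ (k : ℕ) →
    (∀ m → D≤ k n m → turan n (suc (suc k)) ≤ m)
    × D≤ k n (turan n (suc (suc k)) + (n ∸ 1))
theorem6 n@(suc p) _ k = lower-bound n k , Search.upper-bound p k
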